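{- Let $\Sigma$ be a Horn sequent $W,\Gamma,!\Delta\vdash Z$. If $\Sigma$ has a cut-free derivation in propositional linear logic (which can only use the rules I, L$\otimes$, R$\otimes$, L$\multimap$, L$\multimap\oplus$, L$\oplus$, L!, W!, C! listed in the context), then $\Sigma$ is derivable in Horn Linear Logic $\mathbf{HLL}$.
   Context: Positive literals are propositional variables. A simple product is a tensor product $q_1\otimes\cdots\otimes q_k$ ($k\ge 1$) of positive literals; $\otimes$ and $\oplus$ are treated as commutative and associative, so simple products correspond to nonempty finite multisets of literals, and $X\cong Y$ means $X,Y$ represent the same multiset. A Horn implication is a formula $X\multimap Y$ and a $\oplus$-Horn implication is $X\multimap(Y_1\oplus Y_2)$, where $X,Y,Y_1,Y_2$ are simple products. A Horn sequent is a sequent $W,\Gamma,!\Delta\vdash Z$ where $W,Z$ are simple products and $\Gamma,\Delta$ are finite multisets of Horn and $\oplus$-Horn implications ($!\Delta$ denotes $\{!A: A\in\Delta\}$). The linear logic rules that can occur in cut-free derivations of Horn sequents are: I: $X\vdash X$; L$\otimes$: from $\Sigma,X,Y\vdash Z$ infer $\Sigma,X\otimes Y\vdash Z$; R$\otimes$: from $\Sigma_1\vdash Z_1$ and $\Sigma_2\vdash Z_2$ infer $\Sigma_1,\Sigma_2\vdash Z_1\otimes Z_2$; L$\multimap$: from $\Sigma_1\vdash X$ and $Y,\Sigma_2\vdash Z$ infer $\Sigma_1,X\multimap Y,\Sigma_2\vdash Z$; L$\multimap\oplus$: from $\Sigma_1\vdash X$ and $(Y_1\oplus Y_2),\Sigma_2\vdash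 Z$ infer $\Sigma_1,X\multimap(Y_1\oplus Y_2),\Sigma_2\vdash Z$; L$\oplus$: from $\Sigma,Y_1\vdash Z$ and $\Sigma,Y_2\vdash Z$ infer $\Sigma,Y_1\oplus Y_2\vdash Z$; L!: from $\Sigma,A\vdash Z$ infer $\Sigma,!A\vdash Z$; W!: from $\Sigma\vdash Z$ infer $\Sigma,!A\vdash Z$; C!: from $\Sigma,!A,!A\vdash Z$ infer $\Sigma,!A\vdash Z$. $\mathbf{HLL}$ is the calculus on sequents $X,\Gamma,!\Delta\vdash Z$ ($X,Z$ simple products, $\Gamma,\Delta$ multisets of Horn/$\oplus$-Horn implications, and in the conclusion of a rule $(U\otimes V)$ in the antecedent may be identified with $U,V$) with rules: I: $X\vdash X$; L$\otimes$: from $X,\Gamma,!\Delta\vdash Z$ infer $Y,\Gamma,!\Delta\vdash Z$ where $X\cong Y$; H: $X,\,X\multimap Y\vdash Y$; M: from $X,\Gamma,!\Delta\vdash Y$ infer $(X\otimes V),\Gamma,!\Delta\vdash (Y\otimes V)$; $\oplus$-H: from $(Y_1\otimes V),\Gamma,!\Delta\vdash Z$ and $(Y_2\otimes V),\Gamma,!\Delta\vdash Z$ infer $(X\otimes V),\Gamma,X\multimap(Y_1\oplus Y_2),!\Delta\vdash Z$; L!: from $X,\Gamma,A,!\Delta\vdash Z$ infer $X,\Gamma,!A,!\Delta\vdash Z$; W!: from $X,\Gamma,!\Delta\vdash Z$ infer $X,\Gamma,!A,!\Delta\vdash Z$; C!: from $X,\Gamma,!A,!A,!\Delta\vdash Z$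 infer $X,\Gamma,!A,!\Delta\vdash Z$; Cut: from $W,\Gamma_1,!\Delta_1\vdash U$ and $U,\Gamma_2,!\Delta_2\vdash Z$ infer $W,\Gamma_1,\Gamma_2,!\Delta_1,!\Delta_2\vdash Z$. Here $A$ ranges over Horn and $\oplus$-Horn implications.
   Formalization: In the rule ⊕-H of HLL the side product V is allowed to be absent; with V required to be a nonempty simple product the claim fails, since p, p⊸(q⊕q) ⊢ q has a cut-free derivation in linear logic but none in HLL. -}

module Defs where

open import Data.List.Base using (List; []; _∷_; [_]; _++_; map)
open import Data.List.Relation.Binary.Permutation.Propositional using (_↭_)
open import Data.List.Relation.Binary.Pointwise.Base using (Pointwise)
open import Data.Maybe.Base using (Maybe; just; nothing)

infixr 9 !_
infixr 8 _⊗_ _⊗?_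
infixr 7 _⊕_
infixr 6 _⊸_ _⊸[_⊕_]
infix  4 _≅_ _≈_
infix  3 _⊢_ _∣_∣!_⊢ᴴ_

-- P is the set of propositional variables (positive literals).

private
  variable
    P : Set

data Formula (P : Set) : Set where
  lit         : P → Formula P
  _⊗_ _⊕_ _⊸_ : Formula P → Formula P → Formula P
  !_          : Formula P → Formula P

-- ⊗ and ⊕ are read up to commutativity and associativity: _≈_ is the
-- congruence this generates.

data _≈_ {P : Set} : Formula P → Formula P → Set where
  ≈-refl  : ∀ {A} → A ≈ A
  ≈-sym   : ∀ {A B} → A ≈ B → B ≈ A
  ≈-trans : ∀ {A B C} → A ≈ B → B ≈ C → A ≈ C
  ⊗-comm  : ∀ A B → A ⊗ B ≈ B ⊗ A
  ⊗-assoc : ∀ A B C → (A ⊗ B) ⊗ C ≈ A ⊗ (B ⊗ C)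
  ⊕-comm  : ∀ A B → A ⊕ B ≈ B ⊕ A
  ⊕-assoc : ∀ A B C → (A ⊕ B) ⊕ C ≈ A ⊕ (B ⊕ C)
  ⊗-cong  : ∀ {A A′ B B′} → A ≈ A′ → B ≈ B′ → A ⊗ B ≈ A′ ⊗ B′
  ⊕-cong  : ∀ {A A′ B B′} → A ≈ A′ → B ≈ B′ → A ⊕ B ≈ A′ ⊕ B′
  ⊸-cong  : ∀ {A A′ B B′} → A ≈ A′ → B ≈ B′ → A ⊸ B ≈ A′ ⊸ B′
  !-cong  : ∀ {A A′} → A ≈ A′ → ! A ≈ ! A′

-- Antecedents are multisets, given as lists with an exchange rule; conv
-- replaces formulas by formulas identified with them.  The rules are not
-- restricted to Horn formulas.  In particular, the rule L⊸⊕ for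
-- X ⊸ (Y₁ ⊕ Y₂) is the instance B = Y₁ ⊕ Y₂ of ⊸L.

data _⊢_ {P : Set} : List (Formula P) → Formula P → Set where
  exch : ∀ {Σ Σ′ C} → Σ ↭ Σ′ → Σ ⊢ C → Σ′ ⊢ C
  conv : ∀ {Σ Σ′ C C′} → Pointwise _≈_ Σ Σ′ → C ≈ C′ → Σ ⊢ C → Σ′ ⊢ C′
  I    : ∀ {A} → [ A ] ⊢ A
  ⊗L   : ∀ {Σ A B C} → A ∷ B ∷ Σ ⊢ C → A ⊗ B ∷ Σ ⊢ C
  ⊗R   : ∀ {Σ₁ Σ₂ A B} → Σ₁ ⊢ A → Σ₂ ⊢ B → Σ₁ ++ Σ₂ ⊢ A ⊗ B
  ⊸L   : ∀ {Σ₁ Σ₂ A B C} → Σ₁ ⊢ A → B ∷ Σ₂ ⊢ C → A ⊸ B ∷ Σ₁ ++ Σ₂ ⊢ C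
  ⊕L   : ∀ {Σ A B C} → A ∷ Σ ⊢ C → B ∷ Σ ⊢ C → A ⊕ B ∷ Σ ⊢ C
  !L   : ∀ {Σ A C} → A ∷ Σ ⊢ C → ! A ∷ Σ ⊢ C
  !W   : ∀ {Σ A C} → Σ ⊢ C → ! A ∷ Σ ⊢ C
  !C   : ∀ {Σ A C} → ! A ∷ ! A ∷ Σ ⊢ C → ! A ∷ Σ ⊢ C

data SimpleProduct (P : Set) : Set where
  lit : P → SimpleProduct P
  _⊗_ : SimpleProduct P → SimpleProduct P → SimpleProduct P

literals : SimpleProduct P → List P
literals (lit p) = [ p ]
literals (X ⊗ Y) = literals X ++ literals Y

_≅_ : SimpleProduct P → SimpleProduct P → Set
X ≅ Y = literals X ↭ literals Y

data Implication (P : Set) : Set where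
  _⊸_     : (X Y : SimpleProduct P) → Implication P
  _⊸[_⊕_] : (X Y₁ Y₂ : SimpleProduct P) → Implication P

⌜_⌝ : SimpleProduct P → Formula P
⌜ lit p ⌝ = lit p
⌜ X ⊗ Y ⌝ = ⌜ X ⌝ ⊗ ⌜ Y ⌝

⌜_⌝ᴵ : Implication P → Formula P
⌜ X ⊸ Y ⌝ᴵ          = ⌜ X ⌝ ⊸ ⌜ Y ⌝
⌜ X ⊸[ Y₁ ⊕ Y₂ ] ⌝ᴵ = ⌜ X ⌝ ⊸ (⌜ Y₁ ⌝ ⊕ ⌜ Y₂ ⌝)

-- The Horn sequent W, Γ, !Δ ⊢ Z.

record HornSequent (P : Set) : Set where
  constructor hornSequent
  field
    W : SimpleProduct P
    Γ : List (Implication P)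
    Δ : List (Implication P)
    Z : SimpleProduct P

CutFreeLL : HornSequent P → Set
CutFreeLL (hornSequent W Γ Δ Z) =
  ⌜ W ⌝ ∷ map ⌜_⌝ᴵ Γ ++ map (λ A → ! ⌜ A ⌝ᴵ) Δ ⊢ ⌜ Z ⌝

_⊗?_ : SimpleProduct P → Maybe (SimpleProduct P) → SimpleProduct P
X ⊗? just V  = X ⊗ V
X ⊗? nothing = X

-- X ∣ Γ ∣! Δ ⊢ᴴ Z is the sequent X, Γ, !Δ ⊢ Z.  Since U, V in an antecedent
-- is identified with U ⊗ V, there is exactly one simple product on the left.
--
-- The side product V of ⊕-H may be absent.  This matters: otherwise
-- p, p ⊸ (q ⊕ q) ⊢ q, which holds in linear logic, would not be derivable.
-- (In M an absent V would make premise and conclusion coincide.)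

data _∣_∣!_⊢ᴴ_ {P : Set} :
     SimpleProduct P → List (Implication P) → List (Implication P) →
     SimpleProduct P → Set where
  exch : ∀ {X Γ Γ′ Δ Δ′ Z} → Γ ↭ Γ′ → Δ ↭ Δ′ →
         X ∣ Γ ∣! Δ ⊢ᴴ Z → X ∣ Γ′ ∣! Δ′ ⊢ᴴ Z
  I    : ∀ {X} → X ∣ [] ∣! [] ⊢ᴴ X
  L⊗   : ∀ {X Y Γ Δ Z} → X ≅ Y →
         X ∣ Γ ∣! Δ ⊢ᴴ Z → Y ∣ Γ ∣! Δ ⊢ᴴ Z
  H    : ∀ {X Y} → X ∣ [ X ⊸ Y ] ∣! [] ⊢ᴴ Y
  M    : ∀ {X Y V Γ Δ} →
         X ∣ Γ ∣! Δ ⊢ᴴ Y → X ⊗ V ∣ Γ ∣! Δ ⊢ᴴ Y ⊗ V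
  ⊕-H  : ∀ {X Y₁ Y₂ Z Γ Δ} (V : Maybe (SimpleProduct P)) →
         Y₁ ⊗? V ∣ Γ ∣! Δ ⊢ᴴ Z → Y₂ ⊗? V ∣ Γ ∣! Δ ⊢ᴴ Z →
         X ⊗? V ∣ X ⊸[ Y₁ ⊕ Y₂ ] ∷ Γ ∣! Δ ⊢ᴴ Z
  L!   : ∀ {X A Γ Δ Z} → X ∣ A ∷ Γ ∣! Δ ⊢ᴴ Z → X ∣ Γ ∣! A ∷ Δ ⊢ᴴ Z
  W!   : ∀ {X A Γ Δ Z} → X ∣ Γ ∣! Δ ⊢ᴴ Z → X ∣ Γ ∣! A ∷ Δ ⊢ᴴ Z
  C!   : ∀ {X A Γ Δ Z} → X ∣ Γ ∣! A ∷ A ∷ Δ ⊢ᴴ Z → X ∣ Γ ∣! A ∷ Δ ⊢ᴴ Z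
  Cut  : ∀ {W U Z Γ₁ Γ₂ Δ₁ Δ₂} →
         W ∣ Γ₁ ∣! Δ₁ ⊢ᴴ U → U ∣ Γ₂ ∣! Δ₂ ⊢ᴴ Z →
         W ∣ Γ₁ ++ Γ₂ ∣! Δ₁ ++ Δ₂ ⊢ᴴ Z

HLL : HornSequent P → Set
HLL (hornSequent W Γ Δ Z) = W ∣ Γ ∣! Δ ⊢ᴴ Z

{-# OPTIONS --safe #-}

-- The formula Y₁ ⊕ Y₂ in an antecedent is replaced by either of its summands.
-- Every sequent of a cut-free derivation then becomes one Horn sequent for each
-- choice of a summand of each disjunction in it, and all these Horn sequents
-- are derivable in HLL.  For L⊸, let V collect the literals of the second
-- premise other than those of Y: M adds V to the first premise, and Cut composes
-- X ⊗ V ⊢ Y ⊗ V with the second.  For X ⊸ (Y₁ ⊕ Y₂), the second premise supplies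
-- both premises of ⊕-H with the same V, since choices only affect literals.

module Submission where

open import Data.List.Base using (List; []; _∷_; [_]; _++_; map; concatMap)
open import Data.List.Properties using (concatMap-++)
open import Data.List.Relation.Binary.Permutation.Propositional
  using (_↭_; refl; prep; swap; trans; ↭-refl; ↭-sym; ↭-trans; ↭-reflexive)
open import Data.List.Relation.Binary.Permutation.Propositional.Properties
  using (++⁺; ++⁺ˡ; ++⁺ʳ; ++-assoc; ++-comm; ++-identityʳ; shift; shifts)
open import Data.List.Relation.Binary.Pointwise.Base using (Pointwise; []; _∷_)
open import Data.Maybe.Base using (Maybe; just; nothing)
open import Data.Product.Base using (_×_; _,_; ∃-syntax; proj₁; proj₂)
open import Relation.Binary.PropositionalEquality using (_≡_; refl; sym; cong)

open import Defs

infix 4 _∼_ _≋_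
infix 3 _⊩_

private
  variable
    P : Set
    A B : Set
    X X′ Y Y₁ Y₂ Z Z′ : SimpleProduct P
    F F′ G G′ : Formula P

-- Permutations and pointwise relations of lists.

concatMap-↭ : (f : A → List B) {xs ys : List A} →
              xs ↭ ys → concatMap f xs ↭ concatMap f ys
concatMap-↭ f refl         = refl
concatMap-↭ f (prep x p)   = ++⁺ˡ (f x) (concatMap-↭ f p)
concatMap-↭ f (swap x y p) =
  ↭-trans (shifts (f x) (f y)) (++⁺ˡ (f y) (++⁺ˡ (f x) (concatMap-↭ f p)))
concatMap-↭ f (trans p q)  = ↭-trans (concatMap-↭ f p) (concatMap-↭ f q)

Pointwise-++⁻ : ∀ {R : A → B → Set} xs {ys zs} → Pointwise R (xs ++ ys) zs →
                ∃[ us ] ∃[ vs ] zs ≡ us ++ vs × Pointwise R xs us × Pointwise R ys vs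
Pointwise-++⁻ []       rs       = [] , _ , refl , [] , rs
Pointwise-++⁻ (x ∷ xs) (r ∷ rs) with Pointwise-++⁻ xs rs
... | us , vs , refl , rs₁ , rs₂ = _ ∷ us , vs , refl , r ∷ rs₁ , rs₂

Pointwise-↭ : ∀ {R : A → B → Set} {xs ys zs} → xs ↭ ys → Pointwise R ys zs →
              ∃[ ws ] Pointwise R xs ws × ws ↭ zs
Pointwise-↭ refl         rs            = _ , rs , refl
Pointwise-↭ (prep _ p)   (r ∷ rs)      with Pointwise-↭ p rs
... | _ , rs′ , q = _ , r ∷ rs′ , prep _ q
Pointwise-↭ (swap _ _ p) (r₁ ∷ r₂ ∷ rs) with Pointwise-↭ p rs
... | _ , rs′ , q = _ , r₂ ∷ r₁ ∷ rs′ , swap _ _ q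
Pointwise-↭ (trans p q)  rs            with Pointwise-↭ q rs
... | _ , rs′ , q′ with Pointwise-↭ p rs′
... | _ , rs″ , p′ = _ , rs″ , ↭-trans p′ q′

-- Choices of a summand

data Kind : Set where
  product sum : Kind

data Meaning (P : Set) : Set where
  choice : Kind → SimpleProduct P → Meaning P
  imp    : Implication P → Meaning P
  bang   : Implication P → Meaning P

-- Sums have one meaning for each summand.  The kind records whether a choice
-- was made, so that only ⌜ X ⌝ itself has the meaning choice product X.

data Denotes {P : Set} : Formula P → Meaning P → Set where
  lit : ∀ p → Denotes (lit p) (choice product (lit p))
  _⊗_ : Denotes F (choice product X) → Denotes G (choice product Y) →
        Denotes (F ⊗ G) (choice product (X ⊗ Y))
  ⊕₁  : ∀ {k} → Denotes F (choice k X) → Denotes (F ⊕ G) (choice sum X)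
  ⊕₂  : ∀ {k} → Denotes G (choice k X) → Denotes (F ⊕ G) (choice sum X)
  horn   : F ≈ ⌜ X ⌝ → G ≈ ⌜ Y ⌝ → Denotes (F ⊸ G) (imp (X ⊸ Y))
  ⊕-horn : F ≈ ⌜ X ⌝ → G ≈ ⌜ Y₁ ⌝ ⊕ ⌜ Y₂ ⌝ →
        Denotes (F ⊸ G) (imp (X ⊸[ Y₁ ⊕ Y₂ ]))
  !_  : ∀ {i} → Denotes F (imp i) → Denotes (! F) (bang i)

denotes-product : (X : SimpleProduct P) → Denotes ⌜ X ⌝ (choice product X)
denotes-product (lit p) = lit p
denotes-product (X ⊗ Y) = denotes-product X ⊗ denotes-product Y

denotes-imp : (i : Implication P) → Denotes ⌜ i ⌝ᴵ (imp i)
denotes-imp (X ⊸ Y)          = horn ≈-refl ≈-refl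
denotes-imp (X ⊸[ Y₁ ⊕ Y₂ ]) = ⊕-horn ≈-refl ≈-refl

-- Only chosen products may be rearranged: `L⊗` reorders the simple product on the left, but no rule
-- of HLL reorders literals inside an implication.
data _∼_ {P : Set} : Meaning P → Meaning P → Set where
  choice : ∀ {k} → X ≅ Y → choice k X ∼ choice k Y
  imp    : ∀ {i} → imp i ∼ imp i
  bang   : ∀ {i} → bang i ∼ bang i

∼-refl : (m : Meaning P) → m ∼ m
∼-refl (choice k X) = choice ↭-refl
∼-refl (imp i)      = imp
∼-refl (bang i)     = bang

∼-sym : {m n : Meaning P} → m ∼ n → n ∼ m
∼-sym (choice p) = choice (↭-sym p)
∼-sym imp        = imp
∼-sym bang       = bang

∼-trans : {l m n : Meaning P} → l ∼ m → m ∼ n → l ∼ n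
∼-trans (choice p) (choice q) = choice (↭-trans p q)
∼-trans imp        imp        = imp
∼-trans bang       bang       = bang

Transfer : Formula P → Formula P → Set
Transfer F G = ∀ {m} → Denotes F m → ∃[ n ] m ∼ n × Denotes G n

transfer-⊗ : Transfer F F′ → Transfer G G′ → Transfer (F ⊗ G) (F′ ⊗ G′)
transfer-⊗ f g (d ⊗ e) with f d | g e
... | _ , choice p , d′ | _ , choice q , e′ = _ , choice (++⁺ p q) , d′ ⊗ e′

transfer-⊕ : Transfer F F′ → Transfer G G′ → Transfer (F ⊕ G) (F′ ⊕ G′)
transfer-⊕ f g (⊕₁ d) with f d
... | _ , choice p , d′ = _ , choice p , ⊕₁ d′
transfer-⊕ f g (⊕₂ d) with g d
... | _ , choice p , d′ = _ , choice p , ⊕₂ d′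

-- The conversion is absorbed by the `≈` arguments of `horn` and `⊕-horn`, so the implication
-- denoted stays the same.
transfer-⊸ : F′ ≈ F → G′ ≈ G → Transfer (F ⊸ G) (F′ ⊸ G′)
transfer-⊸ p q (horn r s)  = _ , imp , horn (≈-trans p r) (≈-trans q s)
transfer-⊸ p q (⊕-horn r s) = _ , imp , ⊕-horn (≈-trans p r) (≈-trans q s)

transfer-! : Transfer F F′ → Transfer (! F) (! F′)
transfer-! f (! d) with f d
... | _ , imp , d′ = _ , bang , ! d′

transfer-⊗-comm : (F G : Formula P) → Transfer (F ⊗ G) (G ⊗ F)
transfer-⊗-comm F G (_⊗_ {X = X} {Y = Y} d e) =
  _ , choice (++-comm (literals X) (literals Y)) , e ⊗ d

transfer-⊕-comm : (F G : Formula P) → Transfer (F ⊕ G) (G ⊕ F)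
transfer-⊕-comm F G (⊕₁ d) = _ , choice ↭-refl , ⊕₂ d
transfer-⊕-comm F G (⊕₂ d) = _ , choice ↭-refl , ⊕₁ d

-- Proving both directions at once turns the case `≈-sym` into an exchange of components.
transfer-≈ : F ≈ G → Transfer F G × Transfer G F
transfer-≈ ≈-refl          = (λ d → _ , ∼-refl _ , d) , λ d → _ , ∼-refl _ , d
transfer-≈ (≈-sym e)       = proj₂ (transfer-≈ e) , proj₁ (transfer-≈ e)
transfer-≈ (≈-trans e₁ e₂) =
    then (proj₁ (transfer-≈ e₁)) (proj₁ (transfer-≈ e₂))
  , then (proj₂ (transfer-≈ e₂)) (proj₂ (transfer-≈ e₁))
  where
  then : ∀ {F G K : Formula P} → Transfer F G → Transfer G K → Transfer F K
  then f g d with f d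
  ... | _ , p , d′ with g d′
  ... | _ , q , d″ = _ , ∼-trans p q , d″
transfer-≈ (⊗-comm F G)    = transfer-⊗-comm F G , transfer-⊗-comm G F
transfer-≈ (⊗-assoc F G K) = to , from
  where
  to : Transfer ((F ⊗ G) ⊗ K) (F ⊗ (G ⊗ K))
  to (_⊗_ {Y = Z} (_⊗_ {X = X} {Y = Y} d e) f) =
    _ , choice (++-assoc (literals X) (literals Y) (literals Z)) , d ⊗ (e ⊗ f)
  from : Transfer (F ⊗ (G ⊗ K)) ((F ⊗ G) ⊗ K)
  from (_⊗_ {X = X} d (_⊗_ {X = Y} {Y = Z} e f)) =
    _ , choice (↭-sym (++-assoc (literals X) (literals Y) (literals Z))) , (d ⊗ e) ⊗ f
transfer-≈ (⊕-comm F G)    = transfer-⊕-comm F G , transfer-⊕-comm G F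
transfer-≈ (⊕-assoc F G K) = to , from
  where
  to : Transfer ((F ⊕ G) ⊕ K) (F ⊕ (G ⊕ K))
  to (⊕₁ (⊕₁ d)) = _ , choice ↭-refl , ⊕₁ d
  to (⊕₁ (⊕₂ d)) = _ , choice ↭-refl , ⊕₂ (⊕₁ d)
  to (⊕₂ d)      = _ , choice ↭-refl , ⊕₂ (⊕₂ d)
  from : Transfer (F ⊕ (G ⊕ K)) ((F ⊕ G) ⊕ K)
  from (⊕₁ d)      = _ , choice ↭-refl , ⊕₁ (⊕₁ d)
  from (⊕₂ (⊕₁ d)) = _ , choice ↭-refl , ⊕₁ (⊕₂ d)
  from (⊕₂ (⊕₂ d)) = _ , choice ↭-refl , ⊕₂ d
transfer-≈ (⊗-cong e₁ e₂)  with transfer-≈ e₁ | transfer-≈ e₂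
... | f , f⁻ | g , g⁻ = transfer-⊗ f g , transfer-⊗ f⁻ g⁻
transfer-≈ (⊕-cong e₁ e₂)  with transfer-≈ e₁ | transfer-≈ e₂
... | f , f⁻ | g , g⁻ = transfer-⊕ f g , transfer-⊕ f⁻ g⁻
transfer-≈ (⊸-cong e₁ e₂)  =
  transfer-⊸ (≈-sym e₁) (≈-sym e₂) , transfer-⊸ e₁ e₂
transfer-≈ (!-cong e)      with transfer-≈ e
... | f , f⁻ = transfer-! f , transfer-! f⁻

≈-denotes : F ≈ G → Transfer G F
≈-denotes e = proj₂ (transfer-≈ e)

-- A formula with a product meaning is built from literals by `⊗` alone, which leaves nothing to
-- choose.
denotes-unique : ∀ {k} → Denotes F (choice product X) → Denotes F (choice k Y) → X ≡ Y
denotes-unique (lit p) (lit .p) = refl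
denotes-unique (d ⊗ e) (d′ ⊗ e′) with denotes-unique d d′ | denotes-unique e e′
... | refl | refl = refl

-- Derivability of the sequent that results from the choices

atoms : Meaning P → List P
atoms (choice _ X) = literals X
atoms (imp _)      = []
atoms (bang _)     = []

imps : Meaning P → List (Implication P)
imps (imp i) = [ i ]
imps _       = []

bangs : Meaning P → List (Implication P)
bangs (bang i) = [ i ]
bangs _        = []

-- Coarser than permutation of meanings: a chosen tensor may be split into its factors, and kinds
-- are ignored.
record _≋_ {P : Set} (ms ns : List (Meaning P)) : Set where
  constructor mk≋
  field
    atoms-↭ : concatMap atoms ms ↭ concatMap atoms ns
    imps-↭  : concatMap imps  ms ↭ concatMap imps  ns
    bangs-↭ : concatMap bangs ms ↭ concatMap bangs ns

↭⇒≋ : {ms ns : List (Meaning P)} → ms ↭ ns → ms ≋ ns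
↭⇒≋ p = mk≋ (concatMap-↭ atoms p) (concatMap-↭ imps p) (concatMap-↭ bangs p)

∼-∷-≋ : {m n : Meaning P} {ms ns : List (Meaning P)} →
        m ∼ n → ms ≋ ns → m ∷ ms ≋ n ∷ ns
∼-∷-≋ (choice p) (mk≋ a i b) = mk≋ (++⁺ p a) i b
∼-∷-≋ imp        (mk≋ a i b) = mk≋ a (prep _ i) b
∼-∷-≋ bang       (mk≋ a i b) = mk≋ a i (prep _ b)

≋-refl : {ms : List (Meaning P)} → ms ≋ ms
≋-refl = mk≋ ↭-refl ↭-refl ↭-refl

-- Simple products are nonempty, so having an `antecedent` also asserts that the choices in `ms`
-- supply at least one literal.
record _⊩_ {P : Set} (ms : List (Meaning P)) (Z : SimpleProduct P) : Set where
  constructor mk⊩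
  field
    antecedent : SimpleProduct P
    literals-↭ : literals antecedent ↭ concatMap atoms ms
    derivation : antecedent ∣ concatMap imps ms ∣! concatMap bangs ms ⊢ᴴ Z

⊩-≋ : {ms ns : List (Meaning P)} → ms ≋ ns → ms ⊩ Z → ns ⊩ Z
⊩-≋ (mk≋ a i b) (mk⊩ X p d) = mk⊩ X (↭-trans p a) (exch i b d)

-- `L⊗` acts on the left only; on the right, a cut against a rearranged axiom has the same effect.
⊢ᴴ-≅ : ∀ {Γ Δ} → Z ≅ Z′ → X ∣ Γ ∣! Δ ⊢ᴴ Z → X ∣ Γ ∣! Δ ⊢ᴴ Z′
⊢ᴴ-≅ p d = exch (++-identityʳ _) (++-identityʳ _) (Cut d (L⊗ (↭-sym p) I))

⊩-≅ : {ms : List (Meaning P)} → Z ≅ Z′ → ms ⊩ Z → ms ⊩ Z′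
⊩-≅ p (mk⊩ X q d) = mk⊩ X q (⊢ᴴ-≅ p d)

⊗?-mono : ∀ {Γ Δ} V → X ∣ Γ ∣! Δ ⊢ᴴ Y → X ⊗? V ∣ Γ ∣! Δ ⊢ᴴ Y ⊗? V
⊗?-mono nothing  d = d
⊗?-mono (just V) d = M d

⨂ : List P → Maybe (SimpleProduct P)
⨂ []       = nothing
⨂ (p ∷ ps) = just (lit p ⊗? ⨂ ps)

literals-⊗?-⨂ : (X : SimpleProduct P) (ps : List P) →
                literals (X ⊗? ⨂ ps) ↭ literals X ++ ps
literals-⊗?-⨂ X []       = ↭-sym (++-identityʳ _)
literals-⊗?-⨂ X (p ∷ ps) = ++⁺ˡ (literals X) (literals-⊗?-⨂ (lit p) ps)

concatMap-++-↭ : (f : A → List B) (xs ys : List A) →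
                 concatMap f xs ++ concatMap f ys ↭ concatMap f (xs ++ ys)
concatMap-++-↭ f xs ys = ↭-reflexive (sym (concatMap-++ f xs ys))

⊩-cut : (ms ns : List (Meaning P)) → ms ⊩ Y → choice product Y ∷ ns ⊩ Z → ms ++ ns ⊩ Z
⊩-cut {Y = Y} ms ns (mk⊩ X p d) (mk⊩ X′ q e) = mk⊩
  (X ⊗? V)
  (↭-trans (literals-⊗?-⨂ X _) (↭-trans (++⁺ʳ _ p) (concatMap-++-↭ atoms ms ns)))
  (exch (concatMap-++-↭ imps ms ns) (concatMap-++-↭ bangs ms ns)
    (Cut (⊗?-mono V d) (L⊗ (↭-trans q (↭-sym (literals-⊗?-⨂ Y _))) e)))
  where V = ⨂ (concatMap atoms ns)

-- The factors are treated one after the other: `X ⊗ X′` leads to `Y ⊗ X′`, then to `Y ⊗ Z`. The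
-- swaps are there because `M` adds its side product on the right.
⊩-⊗ : (ms ns : List (Meaning P)) → ms ⊩ Y → ns ⊩ Z → ms ++ ns ⊩ Y ⊗ Z
⊩-⊗ {Y = Y} {Z = Z} ms ns (mk⊩ X p d) (mk⊩ X′ q e) = mk⊩
  (X ⊗ X′)
  (↭-trans (++⁺ p q) (concatMap-++-↭ atoms ms ns))
  (exch (concatMap-++-↭ imps ms ns) (concatMap-++-↭ bangs ms ns)
    (Cut (M d) (L⊗ (++-comm (literals X′) (literals Y))
      (⊢ᴴ-≅ (++-comm (literals Z) (literals Y)) (M {V = Y} e)))))

-- This and `⊩-⊸⊕` treat an implication whose left premise is the axiom on `X`; the actual left
-- premise is cut in later.
⊩-⊸ : {ms : List (Meaning P)} →
      choice product Y ∷ ms ⊩ Z → choice product X ∷ imp (X ⊸ Y) ∷ ms ⊩ Z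
⊩-⊸ {X = X} = ⊩-cut (choice product X ∷ imp (X ⊸ _) ∷ []) _
                          (mk⊩ X (↭-sym (++-identityʳ _)) H)

⊩-⊸⊕ : {ms : List (Meaning P)} →
       choice sum Y₁ ∷ ms ⊩ Z → choice sum Y₂ ∷ ms ⊩ Z →
       choice product X ∷ imp (X ⊸[ Y₁ ⊕ Y₂ ]) ∷ ms ⊩ Z
⊩-⊸⊕ {Y₁ = Y₁} {Y₂ = Y₂} {X = X} {ms = ms} (mk⊩ _ p d) (mk⊩ _ q e) = mk⊩
  (X ⊗? V)
  (literals-⊗?-⨂ X _)
  (⊕-H V (L⊗ (↭-trans p (↭-sym (literals-⊗?-⨂ Y₁ _))) d)
         (L⊗ (↭-trans q (↭-sym (literals-⊗?-⨂ Y₂ _))) e))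
  where V = ⨂ (concatMap atoms ms)

-- Induction on cut-free derivations.

Pointwise-≈ : ∀ {Σ Σ′ : List (Formula P)} {ms} → Pointwise _≈_ Σ Σ′ →
              Pointwise Denotes Σ′ ms → ∃[ ns ] Pointwise Denotes Σ ns × ns ≋ ms
Pointwise-≈ []       []       = [] , [] , ≋-refl
Pointwise-≈ (e ∷ es) (d ∷ ds) with ≈-denotes e d | Pointwise-≈ es ds
... | n , p , d′ | ns , ds′ , q = n ∷ ns , d′ ∷ ds′ , ∼-∷-≋ (∼-sym p) q

-- The product meaning forces `F` to be a literal or a tensor, so `m` can only be that same product.
⊩-init : ∀ {m} → Denotes F (choice product Z) → Denotes F m → [ m ] ⊩ Z
⊩-init d@(lit _) e@(lit _) with denotes-unique d e
... | refl = mk⊩ _ (↭-sym (++-identityʳ _)) I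
⊩-init d@(_ ⊗ _) e@(_ ⊗ _) with denotes-unique d e
... | refl = mk⊩ _ (↭-sym (++-identityʳ _)) I

-- Having a meaning stands in for the subformula property: it passes from the conclusion of each
-- rule to the premises. All choices `ms` are covered because one premise may be needed under two of
-- them.
⊢⇒⊩ : ∀ {Σ C Z} {ms : List (Meaning P)} → Σ ⊢ C →
       Denotes C (choice product Z) → Pointwise Denotes Σ ms → ms ⊩ Z
⊢⇒⊩ (exch p D) c ds with Pointwise-↭ p ds
... | _ , ds′ , q = ⊩-≋ (↭⇒≋ q) (⊢⇒⊩ D c ds′)
⊢⇒⊩ (conv es e D) c ds with ≈-denotes e c | Pointwise-≈ es ds
... | _ , choice p , c′ | _ , ds′ , q = ⊩-≅ (↭-sym p) (⊩-≋ q (⊢⇒⊩ D c′ ds′))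
⊢⇒⊩ I c (d ∷ []) = ⊩-init c d
⊢⇒⊩ (⊗L D) c (_⊗_ {X = X} {Y = Y} d e ∷ ds) =
  ⊩-≋ (mk≋ (↭-sym (++-assoc (literals X) (literals Y) _)) ↭-refl ↭-refl)
      (⊢⇒⊩ D c (d ∷ e ∷ ds))
⊢⇒⊩ (⊗R {Σ₁} D E) (c₁ ⊗ c₂) ds with Pointwise-++⁻ Σ₁ ds
... | ms , ns , refl , ds₁ , ds₂ = ⊩-⊗ ms ns (⊢⇒⊩ D c₁ ds₁) (⊢⇒⊩ E c₂ ds₂)
⊢⇒⊩ (⊸L {Σ₁} D E) c (horn {X = X} {Y = Y} p q ∷ ds)
  with Pointwise-++⁻ Σ₁ ds | ≈-denotes p (denotes-product X) | ≈-denotes q (denotes-product Y)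
... | ms , ns , refl , ds₁ , ds₂ | _ , choice r , a | _ , choice s , b =
  -- The formulas derived are only `≈` to `⌜ X ⌝` and `⌜ Y ⌝`; `r` and `s` relate their meanings to
  -- `X` and `Y`. The cut leaves the implication between `ms` and `ns`, and `shift` brings it to the
  -- front.
  ⊩-≋ (↭⇒≋ (shift _ ms ns))
    (⊩-cut ms (imp (X ⊸ Y) ∷ ns) (⊩-≅ (↭-sym r) (⊢⇒⊩ D a ds₁))
      (⊩-⊸ (⊩-≋ (∼-∷-≋ (choice (↭-sym s)) ≋-refl) (⊢⇒⊩ E c (b ∷ ds₂)))))
⊢⇒⊩ (⊸L {Σ₁} D E) c (⊕-horn {X = X} {Y₁ = Y₁} {Y₂ = Y₂} p q ∷ ds)
  with Pointwise-++⁻ Σ₁ ds | ≈-denotes p (denotes-product X)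
     | ≈-denotes q (⊕₁ (denotes-product Y₁)) | ≈-denotes q (⊕₂ (denotes-product Y₂))
... | ms , ns , refl , ds₁ , ds₂ | _ , choice r , a | _ , choice s₁ , b₁ | _ , choice s₂ , b₂ =
  ⊩-≋ (↭⇒≋ (shift _ ms ns))
    (⊩-cut ms (imp (X ⊸[ Y₁ ⊕ Y₂ ]) ∷ ns) (⊩-≅ (↭-sym r) (⊢⇒⊩ D a ds₁))
      (⊩-⊸⊕ (⊩-≋ (∼-∷-≋ (choice (↭-sym s₁)) ≋-refl) (⊢⇒⊩ E c (b₁ ∷ ds₂)))
             (⊩-≋ (∼-∷-≋ (choice (↭-sym s₂)) ≋-refl) (⊢⇒⊩ E c (b₂ ∷ ds₂)))))
-- The choice made selects the premise; only the kind changes, and `atoms` does not see it.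
⊢⇒⊩ (⊕L D E) c (⊕₁ d ∷ ds) = ⊩-≋ (mk≋ ↭-refl ↭-refl ↭-refl) (⊢⇒⊩ D c (d ∷ ds))
⊢⇒⊩ (⊕L D E) c (⊕₂ d ∷ ds) = ⊩-≋ (mk≋ ↭-refl ↭-refl ↭-refl) (⊢⇒⊩ E c (d ∷ ds))
⊢⇒⊩ (!L D) c (! d ∷ ds) with ⊢⇒⊩ D c (d ∷ ds)
... | mk⊩ X p e = mk⊩ X p (L! e)
⊢⇒⊩ (!W D) c (! d ∷ ds) with ⊢⇒⊩ D c ds
... | mk⊩ X p e = mk⊩ X p (W! e)
⊢⇒⊩ (!C D) c (! d ∷ ds) with ⊢⇒⊩ D c (! d ∷ ! d ∷ ds)
... | mk⊩ X p e = mk⊩ X p (C! e)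

-- Meanings of the formulas of a Horn sequent.

meanings : List (Implication P) → List (Implication P) → List (Meaning P)
meanings []      []      = []
meanings []      (i ∷ Δ) = bang i ∷ meanings [] Δ
meanings (i ∷ Γ) Δ       = imp i ∷ meanings Γ Δ

denotes-meanings : (Γ Δ : List (Implication P)) →
  Pointwise Denotes (map ⌜_⌝ᴵ Γ ++ map (λ A → ! ⌜ A ⌝ᴵ) Δ) (meanings Γ Δ)
denotes-meanings []      []      = []
denotes-meanings []      (i ∷ Δ) = ! denotes-imp i ∷ denotes-meanings [] Δ
denotes-meanings (i ∷ Γ) Δ       = denotes-imp i ∷ denotes-meanings Γ Δ

atoms-meanings : (Γ Δ : List (Implication P)) → concatMap atoms (meanings Γ Δ) ≡ []
atoms-meanings []      []      = refl
atoms-meanings []      (i ∷ Δ) = atoms-meanings [] Δ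
atoms-meanings (i ∷ Γ) Δ       = atoms-meanings Γ Δ

imps-meanings : (Γ Δ : List (Implication P)) → concatMap imps (meanings Γ Δ) ≡ Γ
imps-meanings []      []      = refl
imps-meanings []      (i ∷ Δ) = imps-meanings [] Δ
imps-meanings (i ∷ Γ) Δ       = cong (i ∷_) (imps-meanings Γ Δ)

bangs-meanings : (Γ Δ : List (Implication P)) → concatMap bangs (meanings Γ Δ) ≡ Δ
bangs-meanings []      []      = refl
bangs-meanings []      (i ∷ Δ) = cong (i ∷_) (bangs-meanings [] Δ)
bangs-meanings (i ∷ Γ) Δ       = bangs-meanings Γ Δ

theorem1 : ∀ {P : Set} (Σ : HornSequent P) → CutFreeLL Σ → HLL Σ
theorem1 (hornSequent W Γ Δ Z) D
  with ⊢⇒⊩ D (denotes-product Z) (denotes-product W ∷ denotes-meanings Γ Δ)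
... | mk⊩ X p d rewrite atoms-meanings Γ Δ | imps-meanings Γ Δ | bangs-meanings Γ Δ =
  -- All atoms come from `W`, so `X` is a rearrangement of it.
  L⊗ (↭-trans p (++-identityʳ _)) d
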